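{- Let $S\subseteq\mathbb{N}^{\mathbb{N}}$. Then $S$ is $\boldsymbol{\Delta}^0_2$ if and only if $S_{\infty}=\emptyset$.
   Context: $\mathbb{N}^{\mathbb{N}}$ is Baire space (all functions $f:\mathbb{N}\to\mathbb{N}$, with the product topology of the discrete topology), and $\boldsymbol{\Delta}^0_2$ is the boldface Borel pointclass of subsets of $\mathbb{N}^{\mathbb{N}}$ that are both $F_\sigma$ and $G_\delta$. $\mathbb{N}^{<\mathbb{N}}$ is the set of finite sequences of natural numbers (including the empty sequence). For sequences $x,y$ (finite or infinite), $x\subseteq y$ means that $x$ is an initial segment of $y$. For $X\subseteq\mathbb{N}^{<\mathbb{N}}$, $[X]\subseteq\mathbb{N}^{\mathbb{N}}$ denotes the set of infinite sequences all of whose finite initial segments are in $X$. For $S\subseteq\mathbb{N}^{\mathbb{N}}$, define $S_{\alpha}\subseteq\mathbb{N}^{<\mathbb{N}}$ for every ordinal $\alpha$ by transfinite recursion: $S_0=\mathbb{N}^{<\mathbb{N}}$; $S_{\lambda}=\bigcap_{\beta<\lambda}S_{\beta}$ for every limit ordinal $\lambda$ (that is, $\lambda$ nonzero and not a successor); and for every ordinal $\beta$, $$S_{\beta+1}=\{x\in S_{\beta} : \text{there exist } x',x''\in[S_{\beta}] \text{ such that } x\subseteq x',\ x\subseteq x'',\ x'\in S,\ \text{and } x''\notin S\}.$$ Let $\alpha(S)$ be the least ordinal $\alpha$ such that $S_{\alpha}=S_{\alpha+1}$, and let $S_{\infty}=S_{\alpha(S)}$. -}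

module Defs where

open import Axiom.ExcludedMiddle using (ExcludedMiddle)
open import Data.Empty using (⊥; ⊥-elim)
open import Data.List.Base using (List; applyUpTo)
open import Data.List.Relation.Unary.All using (All)
open import Data.Nat.Base using (ℕ)
open import Data.Product.Base using (Σ; ∃; ∃-syntax; _×_; _,_; proj₁; proj₂; swap)
open import Data.Unit.Base using (⊤; tt)
open import Induction.WellFounded using (Acc; acc; WellFounded)
open import Level using (Level; 0ℓ; Lift; lift; lower) renaming (suc to lsuc)
open import Relation.Binary.PropositionalEquality.Core using (_≡_)
open import Relation.Nullary using (¬_; yes; no; contradiction)
open import Relation.Nullary.Decidable using (map′; True; toWitness; fromWitness)
open import Relation.Unary using (Pred; _∈_; _∉_; _⊆_; _≐_; U; ∁; ⋃; ⋂)

private variable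
  ℓ ℓ′ : Level

------------------------------------------------------------------------
-- Baire space

-- Points are identified up to pointwise equality _≗_.
Baire : Set
Baire = ℕ → ℕ

-- In the product of discrete spaces, the cylinders
-- { g | g i ≡ f i for all i in F }, with F finite, form a basis at f.
IsOpen : Pred Baire ℓ → Set ℓ
IsOpen V = ∀ f → f ∈ V →
  ∃[ F ] (∀ g → All (λ i → g i ≡ f i) F → g ∈ V)

IsClosed : Pred Baire ℓ → Set ℓ
IsClosed C = IsOpen (∁ C)

IsFσ : Pred Baire 0ℓ → Set₁
IsFσ S = Σ (ℕ → Pred Baire 0ℓ) λ C → (∀ n → IsClosed (C n)) × (S ≐ ⋃ ℕ C)

IsGδ : Pred Baire 0ℓ → Set₁
IsGδ S = Σ (ℕ → Pred Baire 0ℓ) λ V → (∀ n → IsOpen (V n)) × (S ≐ ⋂ ℕ V)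

IsΔ⁰₂ : Pred Baire 0ℓ → Set₁
IsΔ⁰₂ S = IsFσ S × IsGδ S

-- Initial segments of infinite sequences.
infix 4 _⊑_
_⊑_ : List ℕ → Baire → Set
x ⊑ f = ∃[ n ] x ≡ applyUpTo f n

⟦_⟧ : Pred (List ℕ) ℓ → Pred Baire ℓ
⟦ X ⟧ f = ∀ x → x ⊑ f → x ∈ X

------------------------------------------------------------------------
-- Ordinals

-- sup A f is the least ordinal strictly above every f a.  Different trees
-- may denote the same ordinal, so equality of ordinals is _≈_ below.
data Ord : Set₁ where
  sup : (A : Set) → (A → Ord) → Ord

infix 4 _≤_ _<_ _≈_
_≤_ _<_ : Ord → Ord → Set
sup A f ≤ β = ∀ a → f a < β
α < sup B g = ∃[ b ] α ≤ g b

_≈_ : Ord → Ord → Set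
α ≈ β = α ≤ β × β ≤ α

zero : Ord
zero = sup ⊥ λ ()

suc : Ord → Ord
suc α = sup ⊤ λ _ → α

IsLimit : Ord → Set₁
IsLimit α = ¬ (α ≈ zero) × ¬ (∃[ β ] α ≈ suc β)

≤-refl : ∀ α → α ≤ α
≤-refl (sup A f) a = a , ≤-refl (f a)

≤-trans : ∀ α β γ → α ≤ β → β ≤ γ → α ≤ γ
<-≤-trans : ∀ α β γ → α < β → β ≤ γ → α < γ
≤-<-trans : ∀ α β γ → α ≤ β → β < γ → α < γ
≤-trans (sup A f) β γ p q a = <-≤-trans (f a) β γ (p a) q
<-≤-trans α (sup B g) γ (b , p) q = ≤-<-trans α (g b) γ p (q b)
≤-<-trans α β (sup C h) p (c , q) = c , ≤-trans α β (h c) p q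

≈-refl : ∀ α → α ≈ α
≈-refl α = ≤-refl α , ≤-refl α

≈-sym : ∀ {α β} → α ≈ β → β ≈ α
≈-sym = swap

≈-trans : ∀ α β γ → α ≈ β → β ≈ γ → α ≈ γ
≈-trans α β γ (p , p′) (q , q′) = ≤-trans α β γ p q , ≤-trans γ β α q′ p′

<⇒≤ : ∀ α β → α < β → α ≤ β
<⇒≤ (sup A f) (sup B g) (b , p) a = b , <⇒≤ (f a) (g b) (p a)

α<sucα : ∀ α → α < suc α
α<sucα α = tt , ≤-refl α

≈suc⇒< : ∀ α β → α ≈ suc β → β < α
≈suc⇒< α β (_ , p) = p tt

suc-injective : ∀ α β → suc α ≈ suc β → α ≈ β
suc-injective α β (p , q) = proj₂ (p tt) , proj₂ (q tt)

≤⇒Acc : ∀ α β → β ≤ α → Acc _<_ β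
≤⇒Acc (sup A f) β p = acc λ {γ} γ<β →
  let a , q = <-≤-trans γ β (sup A f) γ<β p in ≤⇒Acc (f a) γ q

<-wellFounded : WellFounded _<_
<-wellFounded α = ≤⇒Acc α α (≤-refl α)

------------------------------------------------------------------------
-- The derivation process

module Derivation (S : Pred Baire 0ℓ) where

  D : Pred (List ℕ) ℓ → Pred (List ℕ) ℓ
  D X x = x ∈ X × ∃[ x′ ] ∃[ x″ ]
    (x′ ∈ ⟦ X ⟧ × x″ ∈ ⟦ X ⟧ × x ⊑ x′ × x ⊑ x″ × x′ ∈ S × x″ ∉ S)

  D-mono : {X : Pred (List ℕ) ℓ} {Y : Pred (List ℕ) ℓ′} → X ⊆ Y → D X ⊆ D Y
  D-mono X⊆Y (x∈X , x′ , x″ , x′∈ , x″∈ , rest) =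
    X⊆Y x∈X , x′ , x″ ,
    (λ y y⊑ → X⊆Y (x′∈ y y⊑)) , (λ y y⊑ → X⊆Y (x″∈ y y⊑)) , rest

  -- stage α is S_α, by recursion along _<_.  The first conjunct is vacuous
  -- unless α is a limit, the second unless α is a successor; for α ≈ zero
  -- nothing is required.  The resulting recursion equations are stage-zero,
  -- stage-limit and stage-suc.
  stageAcc : ∀ α → Acc _<_ α → Pred (List ℕ) (lsuc 0ℓ)
  stageAcc α (acc rs) x =
    (IsLimit α → ∀ β (β<α : β < α) → x ∈ stageAcc β (rs β<α)) ×
    (∀ β (e : α ≈ suc β) → x ∈ D (stageAcc β (rs (≈suc⇒< α β e))))

  stage : Ord → Pred (List ℕ) (lsuc 0ℓ)
  stage α = stageAcc α (<-wellFounded α)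

  stageAcc-resp : ∀ α α′ (p : Acc _<_ α) (p′ : Acc _<_ α′) →
                  α ≈ α′ → stageAcc α p ⊆ stageAcc α′ p′
  stageAcc-resp α α′ (acc rs) (acc rs′) e (lim , succ) =
    (λ (nz , ns) β β<α′ →
      let β<α = <-≤-trans β α′ α β<α′ (proj₂ e) in
      stageAcc-resp β β (rs β<α) (rs′ β<α′) (≈-refl β)
        (lim ( (λ z → nz (≈-trans α′ α zero (≈-sym {α} {α′} e) z))
             , (λ (γ , s) → ns (γ , ≈-trans α′ α (suc γ) (≈-sym {α} {α′} e) s)))
             β β<α)) ,
    (λ β e′ → let e″ = ≈-trans α α′ (suc β) e e′ in
      D-mono (stageAcc-resp β β (rs (≈suc⇒< α β e″)) (rs′ (≈suc⇒< α′ β e′)) (≈-refl β))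
        (succ β e″))

  stage-resp : ∀ {α β} → α ≈ β → stage α ⊆ stage β
  stage-resp {α} {β} = stageAcc-resp α β (<-wellFounded α) (<-wellFounded β)

  stage-zero : stage zero ≐ U
  stage-zero = _ , λ _ →
    (λ (nz , _) → contradiction (≈-refl zero) nz) ,
    (λ β (_ , q) → ⊥-elim (proj₁ (q tt)))

  stage-limit : ∀ {α} → IsLimit α → stage α ≐ (λ x → ∀ β → β < α → x ∈ stage β)
  stage-limit {α} l = unfold (<-wellFounded α)
    where
    unfold : ∀ p → stageAcc α p ≐ (λ x → ∀ β → β < α → x ∈ stage β)
    unfold (acc rs) =
      (λ (lim , _) β β<α →
        stageAcc-resp β β (rs β<α) (<-wellFounded β) (≈-refl β) (lim l β β<α)) ,
      (λ h →
        (λ _ β β<α →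
          stageAcc-resp β β (<-wellFounded β) (rs β<α) (≈-refl β) (h β β<α)) ,
        (λ β e → ⊥-elim (proj₂ l (β , e))))

  stage-suc : ∀ {β} → stage (suc β) ≐ D (stage β)
  stage-suc {β} = unfold (<-wellFounded (suc β))
    where
    unfold : ∀ p → stageAcc (suc β) p ≐ D (stage β)
    unfold (acc rs) =
      (λ (_ , succ) →
        D-mono (stageAcc-resp β β (rs (≈suc⇒< (suc β) β (≈-refl (suc β))))
                              (<-wellFounded β) (≈-refl β))
          (succ β (≈-refl (suc β)))) ,
      (λ d →
        (λ (_ , ns) → ⊥-elim (ns (β , ≈-refl (suc β)))) ,
        (λ γ e → D-mono (stageAcc-resp β γ (<-wellFounded β) (rs (≈suc⇒< (suc β) γ e))
                           (suc-injective β γ e)) d))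

  IsStable : Ord → Set₁
  IsStable α = stage α ≐ stage (suc α)

------------------------------------------------------------------------
-- The least stable stage; its existence is where classical logic enters

module Classical (em : ExcludedMiddle (lsuc 0ℓ)) where

  em₀ : ExcludedMiddle 0ℓ
  em₀ {P} = map′ lower lift (em {Lift (lsuc 0ℓ) P})

  ≮⇒≥ : ∀ α β → ¬ (α < β) → β ≤ α
  ≮⇒≥ α (sup B g) α≮β b with em₀ {g b < α}
  ... | yes p = p
  ... | no ¬p = contradiction (b , ≮⇒≥ (g b) α ¬p) α≮β

  module _ (S : Pred Baire 0ℓ) where
    open Derivation S

    stage-antitone : ∀ α β → β < α → stage α ⊆ stage β
    stage-antitone α = go α (<-wellFounded α)
      where
      go : ∀ α → Acc _<_ α → ∀ β → β < α → stage α ⊆ stage β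
      go α (acc rs) β β<α x∈ with em {∃[ γ ] α ≈ suc γ} | em₀ {α ≈ zero}
      ... | no ns | no nz = proj₁ (stage-limit (nz , ns)) x∈ β β<α
      ... | no _  | yes z = ⊥-elim (proj₁ (<-≤-trans β α zero β<α (proj₁ z)))
      ... | yes (γ , e) | _ with em₀ {β < γ}
                               | proj₁ (proj₁ (stage-suc {γ}) (stage-resp {α} {suc γ} e x∈))
      ...   | yes β<γ | x∈γ = go γ (rs (≈suc⇒< α γ e)) β β<γ x∈γ
      ...   | no  β≮γ | x∈γ = stage-resp {γ} {β} (≮⇒≥ β γ β≮γ , β≤γ) x∈γ
        where β≤γ = proj₂ (<-≤-trans β α (suc γ) β<α (proj₁ e))

    Removed : List ℕ → Set₁
    Removed x = ∃[ α ] x ∉ stage α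

    -- An ordinal above some removal stage of each removed sequence.
    bound : Ord
    bound = sup (∃[ x ] True (em {Removed x})) λ (_ , t) → proj₁ (toWitness t)

    bound-stable : IsStable bound
    bound-stable =
      below , λ x∈ → stage-antitone (suc bound) bound (α<sucα bound) x∈
      where
      below : stage bound ⊆ stage (suc bound)
      below {x} x∈ with em {x ∈ stage (suc bound)}
      ... | yes p = p
      ... | no ¬p =
        let t = fromWitness {a? = em {Removed x}} (suc bound , ¬p)
            β , x∉ = toWitness t
        in contradiction (stage-antitone bound β ((x , t) , ≤-refl β) x∈) x∉

    least : Σ Ord λ α → IsStable α × (∀ β → IsStable β → α ≤ β)
    least = go bound (<-wellFounded bound) bound-stable
      where
      go : ∀ α → Acc _<_ α → IsStable α →
           Σ Ord λ α → IsStable α × (∀ β → IsStable β → α ≤ β)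
      go α (acc rs) st with em {∃[ β ] (β < α × IsStable β)}
      ... | yes (β , β<α , st′) = go β (rs β<α) st′
      ... | no ¬p = α , st , λ β st′ → ≮⇒≥ β α λ β<α → ¬p (β , β<α , st′)

    -- The ordinal α(S).  Only its _≈_-class is canonical, and stage-resp
    -- shows that S∞ depends on nothing more.
    rank : Ord
    rank = proj₁ least

    S∞ : Pred (List ℕ) (lsuc 0ℓ)
    S∞ = stage rank

{-# OPTIONS --safe #-}
-- If S∞ is nonempty, then S and its complement are both dense in [S∞]; when
-- both are Gδ, the Baire category argument inside [S∞] yields a common point.
-- If S∞ is empty, each x has a β with x ∈ S_β and x ∉ S_{β+1}, so S is either
-- full or empty on the closed set of extensions of x in [S_β].  A point f lies
-- in that set for the prefix x of f with the smallest β.  Hence S and its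
-- complement are countable unions of closed sets, one for each length of x.
module Submission where

open import Defs
open import Axiom.ExcludedMiddle using (ExcludedMiddle)
open import Function.Bundles using (_⇔_)
open import Level using (0ℓ) renaming (suc to lsuc)
open import Relation.Binary.PropositionalEquality using (_≗_)
open import Relation.Unary using (Pred; Empty)
open import Relation.Binary.Definitions using (_Respects_)

open import Data.List.Base using (List; applyUpTo; upTo)
open import Data.List.Extrema.Nat using (max; xs≤max)
open import Data.List.Properties using (∷-injective)
import Data.List.Relation.Unary.All as All
open import Data.List.Relation.Unary.All.Properties using (applyUpTo⁻)
open import Data.Nat.Base as ℕ using (ℕ; _⊔_)
import Data.Nat.Properties as ℕ
open import Data.Product.Base using (Σ; ∃; ∃-syntax; _×_; _,_; proj₁; proj₂)
open import Data.Sum.Base using (inj₁; inj₂)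
open import Function.Base using (id)
open import Function.Bundles using (mk⇔)
open import Induction.WellFounded using (Acc; acc)
open import Level using (Level)
open import Relation.Binary.PropositionalEquality
  using (_≡_; refl; sym; trans; cong; cong₂; subst)
open import Relation.Nullary using (yes; no; contradiction; decidable-stable)
open import Relation.Nullary.Decidable using (True; toWitness; fromWitness)
open import Relation.Unary using (_∈_; _∉_; _⊆_; _∩_; ∁)

private variable
  ℓ : Level

-- Agreement on initial segments and the topology it generates.

infix 4 _≡[_]_
_≡[_]_ : Baire → ℕ → Baire → Set
f ≡[ k ] g = ∀ i → i ℕ.< k → f i ≡ g i

≡[]-sym : ∀ {f g k} → f ≡[ k ] g → g ≡[ k ] f
≡[]-sym e i i<k = sym (e i i<k)

≡[]-trans : ∀ {f g h k} → f ≡[ k ] g → g ≡[ k ] h → f ≡[ k ] h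
≡[]-trans e e′ i i<k = trans (e i i<k) (e′ i i<k)

≡[]-mono : ∀ {f g k l} → k ℕ.≤ l → f ≡[ l ] g → f ≡[ k ] g
≡[]-mono k≤l e i i<k = e i (ℕ.<-≤-trans i<k k≤l)

applyUpTo-cong : ∀ {f g} k → f ≡[ k ] g → applyUpTo f k ≡ applyUpTo g k
applyUpTo-cong ℕ.zero    e = refl
applyUpTo-cong (ℕ.suc k) e =
  cong₂ List._∷_ (e 0 ℕ.z<s) (applyUpTo-cong k λ i i<k → e (ℕ.suc i) (ℕ.s<s i<k))

applyUpTo-injective : ∀ {f g} k l → applyUpTo f k ≡ applyUpTo g l → f ≡[ k ] g
applyUpTo-injective (ℕ.suc k) (ℕ.suc l) e ℕ.zero    _     = proj₁ (∷-injective e)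
applyUpTo-injective (ℕ.suc k) (ℕ.suc l) e (ℕ.suc i) i<k =
  applyUpTo-injective k l (proj₂ (∷-injective e)) i (ℕ.s<s⁻¹ i<k)

-- Initial segments generate the same open sets as arbitrary finite sets of coordinates, and they
-- nest, as the limit construction requires.
HasCylinders : Pred Baire ℓ → Set ℓ
HasCylinders V = ∀ f → f ∈ V → ∃[ k ] (∀ g → g ≡[ k ] f → g ∈ V)

IsOpen⇒HasCylinders : {V : Pred Baire ℓ} → IsOpen V → HasCylinders V
IsOpen⇒HasCylinders open-V f f∈V with open-V f f∈V
-- The bound in `_≡[_]_` is strict; the successor brings the largest coordinate of `F` under it.
... | F , F⊆V = ℕ.suc (max 0 F) , λ g e →
  F⊆V g (All.map (λ {i} i≤ → e i (ℕ.s≤s i≤)) (xs≤max 0 F))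

HasCylinders⇒IsOpen : {V : Pred Baire ℓ} → HasCylinders V → IsOpen V
HasCylinders⇒IsOpen cyl f f∈V with cyl f f∈V
... | k , cyl⊆V = upTo k , λ g e → cyl⊆V g λ i i<k → applyUpTo⁻ id k e i<k

HasCylinders-∩ : {V W : Pred Baire 0ℓ} →
  HasCylinders V → HasCylinders W → HasCylinders (V ∩ W)
HasCylinders-∩ cylV cylW f (f∈V , f∈W) with cylV f f∈V | cylW f f∈W
... | k , k⊆V | l , l⊆W = k ⊔ l , λ g e →
  k⊆V g (≡[]-mono (ℕ.m≤m⊔n k l) e) , l⊆W g (≡[]-mono (ℕ.m≤n⊔m k l) e)

-- Relative density and Baire category.

DenseIn : Pred Baire ℓ → Pred Baire 0ℓ → Set ℓ
DenseIn P V = ∀ f k → f ∈ P → ∃[ g ] (g ∈ P × g ≡[ k ] f × g ∈ V)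

DenseIn-⊆ : {P : Pred Baire ℓ} {V W : Pred Baire 0ℓ} →
  V ⊆ W → DenseIn P V → DenseIn P W
DenseIn-⊆ V⊆W dense f k f∈P with dense f k f∈P
... | g , g∈P , e , g∈V = g , g∈P , e , V⊆W g∈V

-- A point of `V` near `f` has a whole cylinder inside `V`; the density of `W` is then used within
-- that cylinder.
DenseIn-∩ : {P : Pred Baire ℓ} {V W : Pred Baire 0ℓ} →
  HasCylinders V → DenseIn P V → DenseIn P W → DenseIn P (V ∩ W)
DenseIn-∩ cylV denseV denseW f k f∈P with denseV f k f∈P
... | g , g∈P , g≡f , g∈V with cylV g g∈V
...   | l , l⊆V with denseW g (k ⊔ l) g∈P
...     | h , h∈P , h≡g , h∈W =
  h , h∈P , ≡[]-trans (≡[]-mono (ℕ.m≤m⊔n k l) h≡g) g≡f ,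
  l⊆V h (≡[]-mono (ℕ.m≤n⊔m k l) h≡g) , h∈W

-- P is not assumed closed, so the common point may lie outside P.
module _ {P : Pred Baire ℓ} (V : ℕ → Pred Baire 0ℓ)
         (cyl : ∀ n → HasCylinders (V n)) (dense : ∀ n → DenseIn P (V n)) where

  private
    -- A point of `P` with the length of the prefix that later points must keep.
    State : Set _
    State = ∃ P × ℕ

    point : State → Baire
    point ((f , _) , _) = f

    depth : State → ℕ
    depth (_ , k) = k

    refine : ∀ n (s : State) → Σ State λ t →
      depth s ℕ.< depth t × point t ≡[ depth s ] point s ×
      (∀ h → h ≡[ depth t ] point t → h ∈ V n)
    refine n ((f , f∈P) , k) with dense n f k f∈P
    ... | g , g∈P , g≡f , g∈V with cyl n g g∈V
    -- `ℕ.suc k` makes the depth grow even if `l` is small; `l` puts the cylinder inside `V n`.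
    ...   | l , l⊆V = ((g , g∈P) , ℕ.suc k ⊔ l) , ℕ.m≤m⊔n (ℕ.suc k) l , g≡f ,
      λ h h≡g → l⊆V h (≡[]-mono (ℕ.m≤n⊔m (ℕ.suc k) l) h≡g)

  baire-category : ∃ P → ∃[ h ] (∀ n → h ∈ V n)
  baire-category f = limit , λ n →
    proj₂ (proj₂ (proj₂ (refine n (state n)))) limit (limit≡state (ℕ.suc n))
    where
    state : ℕ → State
    state ℕ.zero    = f , 0
    state (ℕ.suc n) = proj₁ (refine n (state n))

    d : ℕ → ℕ
    d n = depth (state n)

    d-suc : ∀ n → d n ℕ.< d (ℕ.suc n)
    d-suc n = proj₁ (proj₂ (refine n (state n)))

    n≤d : ∀ n → n ℕ.≤ d n
    n≤d ℕ.zero    = ℕ.z≤n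
    n≤d (ℕ.suc n) = ℕ.≤-<-trans (n≤d n) (d-suc n)

    -- Both claims share one induction: the growth of the depths lets the agreement of the last step
    -- be cut down to length `d m`.
    coherent′ : ∀ {m n} → m ℕ.≤′ n →
      d m ℕ.≤ d n × point (state n) ≡[ d m ] point (state m)
    coherent′ ℕ.≤′-refl = ℕ.≤-refl , λ _ _ → refl
    coherent′ (ℕ.≤′-step {n} m≤n) with coherent′ m≤n
    ... | dm≤dn , e =
      ℕ.≤-trans dm≤dn (ℕ.<⇒≤ (d-suc n)) ,
      ≡[]-trans (≡[]-mono dm≤dn (proj₁ (proj₂ (proj₂ (refine n (state n)))))) e

    coherent : ∀ {m n} → m ℕ.≤ n → point (state n) ≡[ d m ] point (state m)
    coherent m≤n = proj₂ (coherent′ (ℕ.≤⇒≤′ m≤n))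

    limit : Baire
    -- Coordinate `i` is settled by state `i + 1`, whose depth is at least `i + 1`.
    limit i = point (state (ℕ.suc i)) i

    limit≡state : ∀ n → limit ≡[ d n ] point (state n)
    limit≡state n i i<dn with ℕ.≤-total n (ℕ.suc i)
    ... | inj₁ n≤1+i = coherent n≤1+i i i<dn
    ... | inj₂ 1+i≤n = sym (coherent 1+i≤n i (n≤d (ℕ.suc i)))

-- Emptiness of the kernel of a Δ⁰₂ set.

module _ (S : Pred Baire 0ℓ) where
  open Derivation S

  -- A prefix of a point of `⟦ X ⟧` lies in `X`, hence in `D X`, whose two witnesses extend it
  -- within `⟦ X ⟧`, one on each side of `S`.
  ⊆D⇒DenseIn : {X : Pred (List ℕ) ℓ} → X ⊆ D X →
    DenseIn ⟦ X ⟧ S × DenseIn ⟦ X ⟧ (∁ S)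
  ⊆D⇒DenseIn X⊆D =
    (λ f k f∈ →
      let _ , x′ , _ , x′∈ , _ , (l , e) , _ , x′∈S , _ = X⊆D (f∈ _ (k , refl))
      in x′ , x′∈ , ≡[]-sym (applyUpTo-injective k l e) , x′∈S) ,
    (λ f k f∈ →
      let _ , _ , x″ , _ , x″∈ , _ , (l , e) , _ , x″∉S = X⊆D (f∈ _ (k , refl))
      in x″ , x″∈ , ≡[]-sym (applyUpTo-injective k l e) , x″∉S)

  Δ⁰₂⇒⊆D-empty : IsΔ⁰₂ S → {X : Pred (List ℕ) ℓ} → X ⊆ D X → Empty X
  Δ⁰₂⇒⊆D-empty ((C , closed , S⊆C , C⊆S) , (V , open-V , S⊆V , V⊆S)) {X} X⊆D x x∈ =
    let _ , x′ , _ , x′∈ , _ = X⊆D x∈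
        -- Each `V n` contains `S` and each `∁ (C n)` contains `∁ S`, so both are dense in `⟦ X ⟧`.
        -- A point of all `V n` is in `S`, hence in some `C n`.
        h , h∈ = baire-category (λ n → V n ∩ ∁ (C n))
          (λ n → HasCylinders-∩ (cylV n) (IsOpen⇒HasCylinders (closed n)))
          (λ n → DenseIn-∩ (cylV n)
            (DenseIn-⊆ (λ f∈S → S⊆V f∈S n) denseS)
            (DenseIn-⊆ (λ f∉S f∈C → f∉S (C⊆S (n , f∈C))) dense∁S))
          (x′ , x′∈)
        n , h∈C = S⊆C (V⊆S λ n → proj₁ (h∈ n))
    in proj₂ (h∈ n) h∈C
    where
    cylV : ∀ n → HasCylinders (V n)
    cylV n = IsOpen⇒HasCylinders (open-V n)

    denseS : DenseIn ⟦ X ⟧ S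
    denseS = proj₁ (⊆D⇒DenseIn X⊆D)

    dense∁S : DenseIn ⟦ X ⟧ (∁ S)
    dense∁S = proj₂ (⊆D⇒DenseIn X⊆D)

-- Closed decompositions from removal ranks.

module _ (em : ExcludedMiddle (lsuc 0ℓ)) where
  open Classical em

  minimum : {A : Set} (r : A → Ord) → A → ∃[ a ] (∀ b → r a ≤ r b)
  minimum {A} r a = go a (<-wellFounded (r a))
    where
    go : ∀ a → Acc _<_ (r a) → ∃[ a ] (∀ b → r a ≤ r b)
    go a (acc rs) with em₀ {∃[ b ] r b < r a}
    ... | yes (b , b<a) = go b (rs b<a)
    ... | no ¬b = a , λ b → ≮⇒≥ (r b) (r a) λ b<a → ¬b (b , b<a)

  module _ (S : Pred Baire 0ℓ) where
    open Derivation S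

    stage-antitone-≤ : ∀ {α β} → β ≤ α → stage α ⊆ stage β
    stage-antitone-≤ {α} {β} β≤α x∈ with em₀ {β < α}
    ... | yes β<α = stage-antitone S α β β<α x∈
    ... | no  β≮α = stage-resp {α} {β} (≮⇒≥ β α β≮α , β≤α) x∈

    -- The least stage omitting `x` is neither zero nor a limit, so it is a successor, and its
    -- predecessor serves as `β`.
    removal : ∀ {α x} → x ∉ stage α → ∃[ β ] (x ∈ stage β × x ∉ D (stage β))
    removal {α} {x} = go α (<-wellFounded α)
      where
      go : ∀ α → Acc _<_ α → x ∉ stage α → ∃[ β ] (x ∈ stage β × x ∉ D (stage β))
      go α (acc rs) x∉ with em {∃[ γ ] (γ < α × x ∉ stage γ)}
      ... | yes (γ , γ<α , x∉γ) = go γ (rs γ<α) x∉γ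
      ... | no ¬γ with em {∃[ β ] α ≈ suc β} | em₀ {α ≈ zero}
      ...   | yes (β , e) | _ =
        β , below β (≈suc⇒< α β e) ,
        λ x∈D → x∉ (stage-resp {suc β} {α} (≈-sym {α} e) (proj₂ (stage-suc {β}) x∈D))
        where
        below : ∀ γ → γ < α → x ∈ stage γ
        below γ γ<α = decidable-stable em λ x∉γ → ¬γ (γ , γ<α , x∉γ)
      ...   | no _ | yes z =
        contradiction (stage-resp {zero} {α} (≈-sym {α} z) (proj₂ stage-zero _)) x∉
      ...   | no ns | no nz =
        contradiction (proj₂ (stage-limit (nz , ns)) λ γ γ<α →
          decidable-stable em λ x∉γ → ¬γ (γ , γ<α , x∉γ)) x∉

    module _ (removalRank : List ℕ → Ord)
             (survives : ∀ x → x ∈ stage (removalRank x))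
             (removed : ∀ x → x ∉ D (stage (removalRank x))) where

      -- stage lives in Set₁, while Fσ unions range over predicates in Set.
      Homogeneous : ℕ → Pred Baire 0ℓ
      Homogeneous n f = True (em {f ∈ ⟦ stage (removalRank (applyUpTo f n)) ⟧})

      -- The points share their prefix of length `n`, hence its rank; if `S` separated them, they
      -- would witness that this prefix is in `D` of its stage.
      homogeneous : ∀ {n f g} → f ∈ Homogeneous n → g ∈ Homogeneous n →
        g ≡[ n ] f → f ∈ S → g ∈ S
      homogeneous {n} {f} {g} f∈ g∈ e f∈S = decidable-stable em₀ λ g∉S →
        let x = applyUpTo f n
            eq = applyUpTo-cong n e
        in removed x (survives x , f , g , toWitness f∈ ,
             subst (λ x → g ∈ ⟦ stage (removalRank x) ⟧) eq (toWitness g∈) ,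
             (n , refl) , (n , sym eq) , f∈S , g∉S)

      -- Each prefix of `f` survives to its own rank and stages decrease, so all prefixes lie in the
      -- stage of the least rank among them.
      Homogeneous-cover : ∀ f → ∃[ n ] f ∈ Homogeneous n
      Homogeneous-cover f with minimum (λ n → removalRank (applyUpTo f n)) 0
      ... | n , least = n , fromWitness λ where
        x (m , refl) →
          stage-antitone-≤ {removalRank x} {removalRank (applyUpTo f n)} (least m)
            (survives x)

      ∉Homogeneous⇒cylinder : ∀ {n f} → f ∉ Homogeneous n →
        ∃[ k ] (∀ g → g ≡[ k ] f → g ∉ Homogeneous n)
      ∉Homogeneous⇒cylinder {n} {f} f∉
        with em {∃[ m ] applyUpTo f m ∉ stage (removalRank (applyUpTo f n))}
      ... | no ¬m = contradiction (fromWitness λ where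
              x (m , refl) → decidable-stable em λ x∉ → ¬m (m , x∉)) f∉
      -- The first `n` values fix the stage; the first `m` give a prefix outside it.
      ... | yes (m , x∉) = n ⊔ m , λ g e g∈ →
        x∉ (subst (λ x → applyUpTo f m ∈ stage (removalRank x))
              (applyUpTo-cong n (≡[]-mono (ℕ.m≤m⊔n n m) e))
              (toWitness g∈ (applyUpTo f m)
                (m , applyUpTo-cong m (≡[]-sym (≡[]-mono (ℕ.m≤n⊔m n m) e)))))

      -- Within `Homogeneous n`, membership in `T` depends only on the first `n` values; a point
      -- outside has a cylinder that avoids `Homogeneous n`.
      Homogeneous-∩-closed : (T : Pred Baire 0ℓ) →
        (∀ {n f g} → f ∈ Homogeneous n → g ∈ Homogeneous n →
          g ≡[ n ] f → f ∈ T → g ∈ T) →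
        ∀ n → IsClosed (Homogeneous n ∩ T)
      Homogeneous-∩-closed T hom n = HasCylinders⇒IsOpen λ f f∉ → cylinder f f∉
        where
        cylinder : HasCylinders (∁ (Homogeneous n ∩ T))
        cylinder f f∉ with em₀ {f ∈ Homogeneous n}
        ... | yes f∈H = n , λ g e (g∈H , g∈T) →
          f∉ (f∈H , hom {n} {g} {f} g∈H f∈H (≡[]-sym e) g∈T)
        ... | no  f∉H with ∉Homogeneous⇒cylinder {n} {f} f∉H
        ...   | k , avoid = k , λ g e (g∈H , _) → avoid g e g∈H

      removalRank⇒Δ⁰₂ : IsΔ⁰₂ S
      removalRank⇒Δ⁰₂ =
        ( (λ n → Homogeneous n ∩ S)
        , Homogeneous-∩-closed S (λ {n} {f} {g} → homogeneous {n} {f} {g})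
        , (λ {f} f∈S → let n , f∈ = Homogeneous-cover f in n , f∈ , f∈S)
        , (λ (_ , _ , f∈S) → f∈S)) ,
        -- The Gδ form of `S` is the complement of an Fσ form of `∁ S`.
        ( (λ n → ∁ (Homogeneous n ∩ ∁ S))
        , Homogeneous-∩-closed (∁ S) (λ {n} {f} {g} f∈ g∈ e f∉S g∈S →
            f∉S (homogeneous {n} {g} {f} g∈ f∈ (≡[]-sym e) g∈S))
        , (λ f∈S _ (_ , f∉S) → f∉S f∈S)
        , (λ {f} f∈V → decidable-stable em₀ λ f∉S →
            let n , f∈ = Homogeneous-cover f in f∈V n (f∈ , f∉S)))

    S∞-empty⇒Δ⁰₂ : Empty (S∞ S) → IsΔ⁰₂ S
    S∞-empty⇒Δ⁰₂ empty = removalRank⇒Δ⁰₂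
      (λ x → proj₁ (rem x)) (λ x → proj₁ (proj₂ (rem x))) (λ x → proj₂ (proj₂ (rem x)))
      where
      rem : ∀ x → ∃[ β ] (x ∈ stage β × x ∉ D (stage β))
      rem x = removal {rank S} {x} (empty x)

theorem9 : (em : ExcludedMiddle (lsuc 0ℓ)) →
    (S : Pred Baire 0ℓ) → S Respects _≗_ →
    IsΔ⁰₂ S ⇔ Empty (Classical.S∞ em S)
theorem9 em S _ = mk⇔
  -- Stability at `rank S` makes `S∞` a subset of its own derivative.
  (λ Δ → Δ⁰₂⇒⊆D-empty S Δ λ x∈ → proj₁ (stage-suc {rank S}) (proj₁ rank-stable x∈))
  (S∞-empty⇒Δ⁰₂ em S)
  where
  open Derivation S
  open Classical em

  rank-stable : IsStable (rank S)
  rank-stable = proj₁ (proj₂ (least S))
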